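{- For every (finite) matrix $M$ with entries in $\{0,1,-1\}$, the geometric grid class $\mathrm{Geom}(M)$ is labelled well-quasi-ordered (lwqo).
   Context: A permutation of length $n$ is an arrangement $\pi=\pi(1)\cdots\pi(n)$ of $1,\dots,n$ (the empty permutation is allowed). Matrices are indexed in Cartesian coordinates, so $M(k,\ell)$ is the entry in the $k$th column from the left and the $\ell$th row from the bottom. The standard figure $\Lambda_M\subset\mathbb{R}^2$ of a $\{0,1,-1\}$ matrix $M$ is the union of: the line segment from $(k-1,\ell-1)$ to $(k,\ell)$ for each $(k,\ell)$ with $M(k,\ell)=1$, and the line segment from $(k-1,\ell)$ to $(k,\ell-1)$ for each $(k,\ell)$ with $M(k,\ell)=-1$. A point set in the plane is independent if no two of its points lie on a common horizontal or vertical line. A finite independent set with $n$ points is in the same relative order as (the plot $\{(i,\pi(i))\}$ of) a unique permutation $\pi$ of length $n$, obtained by labelling the points $1,\dots,n$ from bottom to top and reading the labels from left to right. $\mathrm{Geom}(M)$ is the set of all permutations that are in the same relative order as some finite independent subset of $\Lambda_M$. A quasi-order $(Y,\le)$ is well-quasi-ordered (wqo) if every infinite sequence $y_1,y_2,\dots$ in $Y$ has indices $i<j$ with $y_i\le y_j$. Given a quasi-order $(L,\le_L)$, an $L$-labelled permutation is a pair $(\pi,\ell_\pi)$ with $\pi$ a permutation of length $n$ and $\ell_\pi:\{1,\dots,n\}\to L$. We say $(\sigma,\ell_\sigma)\le(\pi,\ell_\pi)$, where $\sigma$ and $\pi$ have lengths $k$ and $n$, if there are indices $1\le i_1<\cdots<i_k\le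 n$ such that $\pi(i_1)\cdots\pi(i_k)$ is order isomorphic to $\sigma$ and $\ell_\sigma(j)\le_L\ell_\pi(i_j)$ for all $1\le j\le k$. For a set $X$ of permutations, $X\wr L$ is the set of all $L$-labelled members of $X$ under this order. The set $X$ is lwqo if $X\wr L$ is wqo for every wqo $(L,\le_L)$. -}

module Defs where

open import Data.Empty using (⊥)
open import Data.Fin as Fin using (Fin; toℕ)
open import Data.Fin.Permutation using (Permutation′; _⟨$⟩ʳ_)
open import Data.Integer using (+_)
open import Data.Nat as ℕ using (ℕ; suc)
import Data.Nat.Properties as ℕ
open import Data.Product using (Σ; ∃; ∃₂; _×_; _,_; proj₁; proj₂)
open import Data.Rational as ℚ using (ℚ; 0ℚ; 1ℚ; ½; ∣_∣; _/_)
import Data.Rational.Properties as ℚ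
open import Data.Rational.Solver using (module +-*-Solver)
open import Function using (_∘_; id; _⇔_; mk⇔; Equivalence)
open import Level using (Level; 0ℓ; _⊔_) renaming (suc to lsuc)
open import Relation.Binary using (Preorder)
open import Relation.Binary.PropositionalEquality
  using (_≡_; _≢_; refl; sym; trans; cong; subst; isEquivalence)
open import Relation.Nullary using (¬_)
open import Relation.Unary using (Pred; _∈_)

private
  variable
    a ℓ₁ ℓ₂ ℓ : Level
    c r n : ℕ

------------------------------------------------------------------------
-- The real numbers, as Cauchy sequences of rationals.  Equality of reals
-- is _≃_, not _≡_.

IsCauchy : (ℕ → ℚ) → Set
IsCauchy s = ∀ ε → 0ℚ ℚ.< ε →
  ∃ λ N → ∀ m n → N ℕ.≤ m → N ℕ.≤ n → ∣ s m ℚ.- s n ∣ ℚ.< ε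

record ℝ : Set where
  constructor mkℝ
  field
    seq    : ℕ → ℚ
    cauchy : IsCauchy seq

open ℝ public

infix 4 _≃_ _<ᵣ_ _≤ᵣ_

_≃_ : ℝ → ℝ → Set
x ≃ y = ∀ ε → 0ℚ ℚ.< ε →
  ∃ λ N → ∀ n → N ℕ.≤ n → ∣ seq x n ℚ.- seq y n ∣ ℚ.< ε

_<ᵣ_ : ℝ → ℝ → Set
x <ᵣ y = ∃ λ ε → 0ℚ ℚ.< ε ×
  ∃ λ N → ∀ n → N ℕ.≤ n → seq x n ℚ.+ ε ℚ.≤ seq y n

_≤ᵣ_ : ℝ → ℝ → Set
x ≤ᵣ y = ¬ (y <ᵣ x)

fromℚ : ℚ → ℝ
fromℚ q = mkℝ (λ _ → q) λ ε 0<ε → 0 , λ _ _ _ _ →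
  subst (ℚ._< ε) (sym (cong ∣_∣ (ℚ.+-inverseʳ q))) 0<ε

fromℕ : ℕ → ℝ
fromℕ k = fromℚ (+ k / 1)

private
  half-pos : ∀ {ε} → 0ℚ ℚ.< ε → 0ℚ ℚ.< ½ ℚ.* ε
  half-pos {ε} 0<ε =
    subst (ℚ._< ½ ℚ.* ε) (ℚ.*-zeroʳ ½) (ℚ.*-monoʳ-<-pos ½ 0<ε)

  half+half : ∀ ε → ½ ℚ.* ε ℚ.+ ½ ℚ.* ε ≡ ε
  half+half ε =
    trans (sym (ℚ.*-distribʳ-+ ε ½ ½)) (ℚ.*-identityˡ ε)

  interchange : ∀ p q u v →
    (p ℚ.+ q) ℚ.- (u ℚ.+ v) ≡ (p ℚ.- u) ℚ.+ (q ℚ.- v)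
  interchange = solve 4
    (λ p q u v → (p :+ q) :- (u :+ v) := (p :- u) :+ (q :- v)) refl
    where open +-*-Solver

infixl 6 _+ᵣ_ _-ᵣ_
infix  8 -ᵣ_

_+ᵣ_ : ℝ → ℝ → ℝ
x +ᵣ y = mkℝ (λ n → seq x n ℚ.+ seq y n) λ ε 0<ε →
  let N₁ , h₁ = cauchy x (½ ℚ.* ε) (half-pos 0<ε)
      N₂ , h₂ = cauchy y (½ ℚ.* ε) (half-pos 0<ε)
  in N₁ ℕ.⊔ N₂ , λ m n N≤m N≤n →
    let open ℚ.≤-Reasoning
        d₁ = seq x m ℚ.- seq x n
        d₂ = seq y m ℚ.- seq y n
    in begin-strict
      ∣ (seq x m ℚ.+ seq y m) ℚ.- (seq x n ℚ.+ seq y n) ∣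
        ≡⟨ cong ∣_∣ (interchange (seq x m) (seq y m) (seq x n) (seq y n)) ⟩
      ∣ d₁ ℚ.+ d₂ ∣
        ≤⟨ ℚ.∣p+q∣≤∣p∣+∣q∣ d₁ d₂ ⟩
      ∣ d₁ ∣ ℚ.+ ∣ d₂ ∣
        <⟨ ℚ.+-mono-<
             (h₁ m n (ℕ.m⊔n≤o⇒m≤o N₁ N₂ N≤m) (ℕ.m⊔n≤o⇒m≤o N₁ N₂ N≤n))
             (h₂ m n (ℕ.m⊔n≤o⇒n≤o N₁ N₂ N≤m) (ℕ.m⊔n≤o⇒n≤o N₁ N₂ N≤n)) ⟩
      ½ ℚ.* ε ℚ.+ ½ ℚ.* ε
        ≡⟨ half+half ε ⟩
      ε ∎

-ᵣ_ : ℝ → ℝ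
-ᵣ x = mkℝ (λ n → ℚ.- seq x n) λ ε 0<ε →
  let N , h = cauchy x ε 0<ε
  in N , λ m n N≤m N≤n →
    subst (ℚ._< ε)
      (trans (sym (ℚ.∣-p∣≡∣p∣ (seq x m ℚ.- seq x n)))
             (cong ∣_∣ (ℚ.neg-distrib-+ (seq x m) (ℚ.- seq x n))))
      (h m n N≤m N≤n)

_-ᵣ_ : ℝ → ℝ → ℝ
x -ᵣ y = x +ᵣ (-ᵣ y)

------------------------------------------------------------------------
-- Geometric grid classes

Point : Set
Point = ℝ × ℝ

xcoord ycoord : Point → ℝ
xcoord = proj₁
ycoord = proj₂

data Entry : Set where
  0# 1# -1# : Entry

-- Cartesian indexing: M k ℓ is the entry in column k from the left and
-- row ℓ from the bottom, both counted from 0.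
Matrix : ℕ → ℕ → Set
Matrix c r = Fin c → Fin r → Entry

-- The part of the figure inside the cell [k , k+1] × [ℓ , ℓ+1]: the segment
-- from (k , ℓ) to (k+1 , ℓ+1), resp. from (k , ℓ+1) to (k+1 , ℓ),
-- parametrised by t ∈ [0 , 1].
CellFigure : Entry → (k ℓ : ℕ) → Pred Point 0ℓ
CellFigure 0#  k ℓ p = ⊥
CellFigure 1#  k ℓ p = ∃ λ t → fromℚ 0ℚ ≤ᵣ t × t ≤ᵣ fromℚ 1ℚ ×
  xcoord p ≃ fromℕ k +ᵣ t × ycoord p ≃ fromℕ ℓ +ᵣ t
CellFigure -1# k ℓ p = ∃ λ t → fromℚ 0ℚ ≤ᵣ t × t ≤ᵣ fromℚ 1ℚ ×
  xcoord p ≃ fromℕ k +ᵣ t × ycoord p ≃ fromℕ (suc ℓ) -ᵣ t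

StandardFigure : Matrix c r → Pred Point 0ℓ
StandardFigure M p = ∃₂ λ k ℓ → p ∈ CellFigure (M k ℓ) (toℕ k) (toℕ ℓ)

-- A finite independent set of n points is given by an enumeration; the
-- condition makes the enumeration injective.
Independent : (Fin n → Point) → Set
Independent p = ∀ i j → i ≢ j →
  ¬ (xcoord (p i) ≃ xcoord (p j)) × ¬ (ycoord (p i) ≃ ycoord (p j))

-- (i , π(i)) ↦ p i preserves and reflects both coordinate orders.
SameRelativeOrder : (Fin n → Point) → Permutation′ n → Set
SameRelativeOrder p π = ∀ i j →
  (xcoord (p i) <ᵣ xcoord (p j) ⇔ i Fin.< j) ×
  (ycoord (p i) <ᵣ ycoord (p j) ⇔ (π ⟨$⟩ʳ i) Fin.< (π ⟨$⟩ʳ j))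

Perm : Set
Perm = Σ ℕ Permutation′

Geom : Matrix c r → Pred Perm 0ℓ
Geom M (n , π) = ∃ λ (p : Fin n → Point) →
  (∀ i → p i ∈ StandardFigure M) × Independent p × SameRelativeOrder p π

------------------------------------------------------------------------
-- Labelled well-quasi-order

-- This sequence form of wqo behaves as intended only in classical logic:
-- constructively it is not even provably closed under binary products.
WQO : Preorder a ℓ₁ ℓ₂ → Set (a ⊔ ℓ₂)
WQO Y = ∀ (y : ℕ → Carrier) → ∃₂ λ i j → i ℕ.< j × y i ≲ y j
  where open Preorder Y

module _ (X : Pred Perm ℓ) (L : Preorder a ℓ₁ ℓ₂) where
  private module L = Preorder L

  record Labelled : Set (a ⊔ ℓ) where
    constructor labelled
    field
      {length} : ℕ
      perm     : Permutation′ length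
      member   : (length , perm) ∈ X
      label    : Fin length → L.Carrier

  open Labelled

  record _≤ₗ_ (σ π : Labelled) : Set ℓ₂ where
    constructor embedding
    field
      index      : Fin (length σ) → Fin (length π)
      increasing : ∀ i j → i Fin.< j → index i Fin.< index j
      order-iso  : ∀ i j →
        (perm σ ⟨$⟩ʳ i) Fin.< (perm σ ⟨$⟩ʳ j) ⇔
        (perm π ⟨$⟩ʳ index i) Fin.< (perm π ⟨$⟩ʳ index j)
      labels     : ∀ j → label σ j L.≲ label π (index j)

  private
    ≤ₗ-refl : ∀ {σ π} → σ ≡ π → σ ≤ₗ π
    ≤ₗ-refl refl =
      embedding id (λ _ _ → id) (λ _ _ → mk⇔ id id) (λ _ → L.refl)

    ≤ₗ-trans : ∀ {σ τ π} → σ ≤ₗ τ → τ ≤ₗ π → σ ≤ₗ π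
    ≤ₗ-trans (embedding f f↑ f≅ f≲) (embedding g g↑ g≅ g≲) = embedding
      (g ∘ f)
      (λ i j → g↑ (f i) (f j) ∘ f↑ i j)
      (λ i j → mk⇔
        (Equivalence.to (g≅ (f i) (f j)) ∘ Equivalence.to (f≅ i j))
        (Equivalence.from (f≅ i j) ∘ Equivalence.from (g≅ (f i) (f j))))
      (λ j → L.trans (f≲ j) (g≲ (f j)))

  _≀_ : Preorder (a ⊔ ℓ) (a ⊔ ℓ) ℓ₂
  _≀_ = record
    { Carrier    = Labelled
    ; _≈_        = _≡_
    ; _≲_        = _≤ₗ_
    ; isPreorder = record
      { isEquivalence = isEquivalence
      ; reflexive     = ≤ₗ-refl
      ; trans         = ≤ₗ-trans
      }
    }

LWQO : ∀ a ℓ₁ ℓ₂ → Pred Perm ℓ → Set (lsuc (a ⊔ ℓ₁ ⊔ ℓ₂) ⊔ ℓ)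
LWQO a ℓ₁ ℓ₂ X = ∀ (L : Preorder a ℓ₁ ℓ₂) → WQO L → WQO (X ≀ L)

{-# OPTIONS --safe #-}

-- Halve every segment of the figure.  A point is then given by its half
-- segment together with its depth d ∈ [0 , ½], the parameter distance to the
-- end of the full segment that lies in that half; each coordinate is k + d or
-- (k + 1) - d, where the half segment determines k and the sign.  Hence the
-- half segments of two points, and which of the two is deeper, determine their
-- relative order in both directions.  Listing the points by increasing depth
-- turns a labelled permutation into a word over (labels × half segments), and
-- embeddings of words give embeddings of labelled permutations, so Higman's
-- lemma applies.
module Submission where

open import Defs
open import Axiom.ExcludedMiddle using (ExcludedMiddle)
open import Data.Bool using (Bool; true; false)
open import Data.Empty using (⊥)
open import Data.Fin as Fin using (Fin; zero; suc; toℕ; combine; punchIn)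
open import Data.Fin.Patterns using (0F; 1F)
open import Data.Fin.Permutation
  using (Permutation′; _⟨$⟩ʳ_; _⟨$⟩ˡ_; id; insert; insert-punchIn; inverseˡ; inverseʳ)
import Data.Fin.Properties as Fin
open import Data.Integer as ℤ using (+_)
import Data.Integer.Properties as ℤ
open import Data.List using (List; []; _∷_; length; tabulate)
open import Data.List.Relation.Binary.Sublist.Heterogeneous
  using (Sublist; []; _∷_; _∷ʳ_; minimum)
open import Data.Nat as ℕ using (ℕ; zero; suc; _∸_; _≤_; _<_; z<s; s<s; _<?_)
open import Data.Nat.Induction using (<-wellFounded)
import Data.Nat.Properties as ℕ
open import Data.Nat.Properties
  using (≤-refl; ≤-trans; <⇒≤; <⇒≱; ≮⇒≥; <-trans; <-irrefl; <-≤-trans; n<1+n;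
         m<n⇒m<1+n; m<1+n⇒m<n∨m≡n; ∸-monoˡ-<; n∸n≡0)
open import Data.Product using (∃; ∃₂; _×_; _,_; proj₁; proj₂)
open import Data.Rational as ℚ using (ℚ; 0ℚ; 1ℚ; ½; _/_; _+_; _-_; -_; ∣_∣)
import Data.Rational.Properties as ℚ
open import Data.Rational.Solver using (module +-*-Solver)
import Data.Rational.Unnormalised as ℚᵘ
import Data.Rational.Unnormalised.Properties as ℚᵘ
open import Data.Sum using (_⊎_; inj₁; inj₂; [_,_]′)
open import Function using (_∘_; _⇔_; mk⇔; Equivalence)
open import Induction.WellFounded using (Acc; acc)
open import Level using (Level; 0ℓ; _⊔_; Lift; lift; lower)
open import Relation.Binary using (Rel; Preorder; Transitive; Total; tri<; tri≈; tri>)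
open import Relation.Binary.PropositionalEquality
  using (_≡_; _≢_; refl; sym; trans; cong; cong₂; subst; subst₂; ≢-sym)
open import Relation.Nullary using (¬_; Dec; yes; no; contradiction)
open import Relation.Nullary.Decidable using (map′; decidable-stable)
open import Relation.Unary using (Pred; _∈_)
open +-*-Solver using (solve; _:=_; _:+_; _:*_; _:-_; :-_; con)

private
  variable
    a b ℓ ℓ′ ℓ₁ ℓ₂ : Level
    A B C : Set a
    c r k l m n : ℕ

-- Well-quasi-orders and Higman's lemma

Good : Rel A ℓ → (ℕ → A) → Set ℓ
Good R f = ∃₂ λ i j → i < j × R (f i) (f j)

WellQuasi : {A : Set a} → Rel A ℓ → Set (a ⊔ ℓ)
WellQuasi R = ∀ f → Good R f

-- Lifting a proposition to a higher level does not change whether it holds. One hypothesis at level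
-- `a ⊔ ℓ₂` thus serves the label order, the lists and the reals alike.
lower-em : ExcludedMiddle (ℓ ⊔ ℓ′) → ExcludedMiddle ℓ
lower-em {ℓ} {ℓ′} em = map′ lower lift (em {Lift ℓ′ _})

-- Pigeonhole on the first `n + 1` terms.
≡-wellQuasi : WellQuasi (_≡_ {A = Fin n})
≡-wellQuasi f with i , j , i<j , fi≡fj ← Fin.pigeonhole ≤-refl (f ∘ toℕ) =
  toℕ i , toℕ j , i<j , fi≡fj

step⇒monotone : (Q : Rel A ℓ) → Transitive Q → (h : ℕ → A) →
  (∀ k → Q (h k) (h (suc k))) → ∀ {i} j → i < j → Q (h i) (h j)
step⇒monotone Q tr h step (suc j) i<1+j with m<1+n⇒m<n∨m≡n i<1+j
... | inj₁ i<j  = tr {j = h j} (step⇒monotone Q tr h step j i<j) (step j)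
... | inj₂ refl = step j

module _ (em : ExcludedMiddle ℓ) {A : Set a} {R : Rel A ℓ}
         (R-trans : Transitive R) (R-wqo : WellQuasi R) where

  -- Indices with no later R-larger value cannot be cofinal: along them the
  -- sequence would be bad.
  ascending-subsequence : ∀ f → ∃ λ (g : ℕ → ℕ) →
    ∀ {i} j → i < j → g i < g j × R (f (g i)) (f (g j))
  ascending-subsequence f with em {∃ λ N → ∀ i → N ≤ i → ∃ λ j → i < j × R (f i) (f j)}
  ... | yes (N , next) = proj₁ ∘ g , step⇒monotone (λ i j → i < j × R (f i) (f j))
          (λ (p , q) (p′ , q′) → <-trans p p′ , R-trans q q′) (proj₁ ∘ g)
          (λ k → proj₂ (next _ (proj₂ (g k))))
    where
    g : ℕ → ∃ (N ≤_)
    g zero    = N , ≤-refl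
    g (suc k) = let i , N≤i = g k
                    j , i<j , _ = next i N≤i
                in j , ≤-trans N≤i (<⇒≤ i<j)
  ... | no ¬next =
    let i , j , i<j , r = R-wqo (f ∘ t)
    in contradiction (t j , step⇒monotone _<_ <-trans t t-step j i<j , r) (t-stuck i)
    where
    stuck : ∀ N → ∃ λ i → N ≤ i × ¬ (∃ λ j → i < j × R (f i) (f j))
    stuck N with em {∃ λ i → N ≤ i × ¬ (∃ λ j → i < j × R (f i) (f j))}
    ... | yes s = s
    ... | no ¬s = contradiction
      (N , λ i N≤i → decidable-stable em (λ ¬e → ¬s (i , N≤i , ¬e))) ¬next
    t : ℕ → ℕ
    t zero    = proj₁ (stuck 0)
    t (suc k) = proj₁ (stuck (suc (t k)))
    t-step : ∀ k → t k < t (suc k)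
    t-step k = proj₁ (proj₂ (stuck (suc (t k))))
    t-stuck : ∀ k → ¬ (∃ λ j → t k < j × R (f (t k)) (f j))
    t-stuck zero    = proj₂ (proj₂ (stuck 0))
    t-stuck (suc k) = proj₂ (proj₂ (stuck (suc (t k))))

  -- On a subsequence whose first components ascend throughout, a pair that is good for the second
  -- components is good for both.
  ×-wellQuasi : {B : Set b} {S : Rel B ℓ′} → WellQuasi S →
    WellQuasi (λ (x , y) (x′ , y′) → R x x′ × S y y′)
  ×-wellQuasi S-wqo f =
    let g , g↑ = ascending-subsequence (proj₁ ∘ f)
        i , j , i<j , s = S-wqo (proj₂ ∘ f ∘ g)
        gi<gj , r = g↑ j i<j
    in g i , g j , gi<gj , r , s

-- Nash-Williams' minimal bad sequence argument.  Excluded middle decides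
-- Σ-types, so it also supplies the choices.
module Higman {A : Set a} {R : Rel A ℓ} (em : ExcludedMiddle (a ⊔ ℓ))
              (R-trans : Transitive R) (R-wqo : WellQuasi R) where

  private
    Bad : (ℕ → List A) → Set (a ⊔ ℓ)
    Bad f = ∀ {i j} → i < j → ¬ Sublist R (f i) (f j)

    AgreeBelow : ℕ → (f g : ℕ → List A) → Set a
    AgreeBelow n f g = ∀ {i} → i < n → f i ≡ g i

    MinimalAt : ℕ → (ℕ → List A) → Set (a ⊔ ℓ)
    MinimalAt n f = ∀ h → Bad h → AgreeBelow n h f → length (f n) ≤ length (h n)

    -- Descent on the length of term `n`: while some bad sequence with the same earlier terms is
    -- shorter there, replace `f` by it.
    minimise : ∀ n f → Bad f → Acc _<_ (length (f n)) →
      ∃ λ g → Bad g × AgreeBelow n g f × MinimalAt n g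
    minimise n f f-bad (acc rs)
      with em {∃ λ h → Bad h × AgreeBelow n h f × length (h n) < length (f n)}
    ... | no ¬h = f , f-bad , (λ _ → refl) ,
            λ h h-bad h≗f → ≮⇒≥ λ lt → ¬h (h , h-bad , h≗f , lt)
    ... | yes (h , h-bad , h≗f , lt) =
            let g , g-bad , g≗h , g-min = minimise n h h-bad (rs lt)
            in g , g-bad , (λ i<n → trans (g≗h i<n) (h≗f i<n)) , g-min

    module _ (f₀ : ℕ → List A) (f₀-bad : Bad f₀) where

      F : ℕ → ∃ Bad
      F zero    = f₀ , f₀-bad
      F (suc n) = let g , g-bad , _ = minimise n (proj₁ (F n)) (proj₂ (F n)) (<-wellFounded _)
                  in g , g-bad

      -- The diagonal limit of the stages `F`. Passing from stage `n` to stage `suc n` alters no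
      -- term below `n`, so term `n` is frozen from stage `suc n` on.
      w : ℕ → List A
      w n = proj₁ (F (suc n)) n

      F-min : ∀ n → MinimalAt n (proj₁ (F (suc n)))
      F-min n = proj₂ (proj₂ (proj₂
        (minimise n (proj₁ (F n)) (proj₂ (F n)) (<-wellFounded _))))

      F≗w : ∀ n → AgreeBelow n (proj₁ (F n)) w
      F≗w (suc n) i<1+n with m<1+n⇒m<n∨m≡n i<1+n
      ... | inj₂ refl = refl
      ... | inj₁ i<n  = trans
        (proj₁ (proj₂ (proj₂ (minimise n (proj₁ (F n)) (proj₂ (F n)) (<-wellFounded _)))) i<n)
        (F≗w n i<n)

      -- Badness concerns two terms at a time, and terms `i` and `j` of `w` both occur in the bad
      -- sequence of stage `suc j`.
      w-bad : Bad w
      w-bad {i} {j} i<j s = proj₂ (F (suc j)) i<j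
        (subst (λ x → Sublist R x (w j)) (sym (F≗w (suc j) (<-trans i<j (n<1+n j)))) s)

      w-min : ∀ n h → Bad h → AgreeBelow n h w → length (w n) ≤ length (h n)
      w-min n h h-bad h≗w = F-min n h h-bad
        (λ i<n → trans (h≗w i<n) (sym (F≗w (suc n) (m<n⇒m<1+n i<n))))

      -- The empty list embeds in the next term, so a bad sequence has no empty term.
      uncons : ∀ n → ∃₂ λ x xs → w n ≡ x ∷ xs
      uncons n with w n in eq
      ... | x ∷ xs = x , xs , refl
      ... | []     = contradiction
        (subst (λ u → Sublist R u (w (suc n))) (sym eq) (minimum _)) (w-bad (n<1+n n))

      hd : ℕ → A
      hd n = proj₁ (uncons n)

      tl : ℕ → List A
      tl n = proj₁ (proj₂ (uncons n))

      w≡ : ∀ n → w n ≡ hd n ∷ tl n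
      w≡ n = proj₂ (proj₂ (uncons n))

      -- Along a subsequence g with ascending heads, the sequence
      -- w 0, …, w (g 0 ∸ 1), tl (g 0), tl (g 1), … is bad, yet at g 0 it is
      -- shorter than w.
      module _ (g : ℕ → ℕ)
               (g↑ : ∀ {i} j → i < j → g i < g j × R (hd (g i)) (hd (g j))) where

        h′ : ∀ k → Dec (k < g 0) → List A
        h′ k (yes _) = w k
        h′ k (no _)  = tl (g (k ∸ g 0))

        h : ℕ → List A
        h k = h′ k (k <? g 0)

        g0≤ : ∀ k → g 0 ≤ g k
        g0≤ zero    = ≤-refl
        g0≤ (suc k) = <⇒≤ (proj₁ (g↑ (suc k) z<s))

        -- An embedding between terms of `h` would yield one between terms of `w`. If only the later
        -- term is a tail, its missing head is skipped; if both are tails, their heads are matched,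
        -- being related by the choice of `g`.
        h-bad′ : ∀ {i j} p q → i < j → ¬ Sublist R (h′ i p) (h′ j q)
        h-bad′ (yes _) (yes _) i<j s = w-bad i<j s
        h-bad′ {i} {j} (yes i<g0) (no _) _ s = w-bad (<-≤-trans i<g0 (g0≤ (j ∸ g 0)))
          (subst (Sublist R (w i)) (sym (w≡ _)) (hd _ ∷ʳ s))
        h-bad′ (no i≮g0) (yes j<g0) i<j _ = i≮g0 (<-trans i<j j<g0)
        h-bad′ {i} {j} (no i≮g0) (no _) i<j s =
          let gi<gj , r = g↑ (j ∸ g 0) (∸-monoˡ-< i<j (≮⇒≥ i≮g0))
          in w-bad gi<gj (subst₂ (Sublist R) (sym (w≡ _)) (sym (w≡ _)) (r ∷ s))

        h-bad : Bad h
        h-bad {i} {j} = h-bad′ (i <? g 0) (j <? g 0)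

        h≗w : AgreeBelow (g 0) h w
        h≗w {i} i<g0 with i <? g 0
        ... | yes _   = refl
        ... | no i≮g0 = contradiction i<g0 i≮g0

        h′-short : ∀ p → length (h′ (g 0) p) < length (w (g 0))
        h′-short (yes lt) = contradiction lt (<-irrefl refl)
        h′-short (no _)   = subst₂ (λ k u → length (tl (g k)) < length u)
          (sym (n∸n≡0 (g 0))) (sym (w≡ (g 0))) ≤-refl

        impossible : ⊥
        impossible = <⇒≱ (h′-short (g 0 <? g 0)) (w-min (g 0) h h-bad h≗w)

      no-bad : ⊥
      no-bad =
        let g , g↑ = ascending-subsequence (lower-em {ℓ′ = a} em) {R = R} R-trans R-wqo hd
        in impossible g g↑

  Sublist-wellQuasi : WellQuasi (Sublist R)
  Sublist-wellQuasi f = decidable-stable em λ ¬good →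
    no-bad f λ i<j s → ¬good (_ , _ , i<j , s)

-- Increasing maps from sublists, and sorting

Increasing : (Fin m → Fin n) → Set
Increasing f = ∀ i j → i Fin.< j → f i Fin.< f j

Sublist⇒increasing : {R : Rel A ℓ} (u : Fin m → A) (v : Fin n → A) →
  Sublist R (tabulate u) (tabulate v) →
  ∃ λ f → Increasing f × ∀ i → R (u i) (v (f i))
Sublist⇒increasing {m = zero} u v s = (λ ()) , (λ ()) , λ ()
Sublist⇒increasing {m = suc m} {n = suc n} u v (_ ∷ʳ s) =
  let f , f↑ , r = Sublist⇒increasing u (v ∘ suc) s
  in suc ∘ f , (λ i j i<j → s<s (f↑ i j i<j)) , r
Sublist⇒increasing {A = A} {m = suc m} {n = suc n} {R} u v (r₀ ∷ s) = f , f↑ , related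
  where
  rec = Sublist⇒increasing (u ∘ suc) (v ∘ suc) s
  f : Fin (suc m) → Fin (suc n)
  f zero    = zero
  f (suc i) = suc (proj₁ rec i)
  f↑ : Increasing f
  f↑ zero    (suc j) _         = z<s
  f↑ (suc i) (suc j) (s<s i<j) = s<s (proj₁ (proj₂ rec) i j i<j)
  related : ∀ i → R (u i) (v (f i))
  related zero    = r₀
  related (suc i) = proj₂ (proj₂ rec) i

module _ {A : Set a} {_≼_ : Rel A ℓ} (≼-trans : Transitive _≼_) (≼-total : Total _≼_) where

  private
    ≼-refl : ∀ x → x ≼ x
    ≼-refl x = [ (λ p → p) , (λ p → p) ]′ (≼-total x x)

  minimum-index : (d : Fin (suc n) → A) → ∃ λ i → ∀ j → d i ≼ d j
  minimum-index {zero}  d = zero , λ { zero → ≼-refl _ }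
  minimum-index {suc n} d with minimum-index (d ∘ suc)
  ... | i , min with ≼-total (d zero) (d (suc i))
  ...   | inj₁ 0≼i = zero , λ { zero → ≼-refl _ ; (suc j) → ≼-trans 0≼i (min j) }
  ...   | inj₂ i≼0 = suc i , λ { zero → i≼0 ; (suc j) → min j }

  -- Selection sort: `insert zero i₀ σ` sends position 0 to the index `i₀` of a minimum and runs
  -- through the other indices, via `punchIn i₀`, in the order already sorted.
  sorting : (d : Fin n → A) → ∃ λ (σ : Permutation′ n) →
    ∀ i j → i Fin.< j → d (σ ⟨$⟩ʳ i) ≼ d (σ ⟨$⟩ʳ j)
  sorting {zero}  d = id , λ ()
  sorting {suc n} d with minimum-index d
  ... | i₀ , min with sorting (d ∘ punchIn i₀)
  ...   | σ , sorted = insert zero i₀ σ , λ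
          { zero    (suc j) _         → min _
          ; (suc i) (suc j) (s<s i<j) → subst₂ (λ x y → d x ≼ d y)
              (sym (insert-punchIn zero i₀ σ i)) (sym (insert-punchIn zero i₀ σ j))
              (sorted i j i<j) }

-- Order of the Cauchy reals

-- `_/_` normalises its fraction and is stuck on a variable `k`. Over the unnormalised rationals
-- only an identity of integers remains.
fromℕ-suc : ∀ k → + suc k / 1 ≡ + k / 1 + 1ℚ
fromℕ-suc k = ℚ.toℚᵘ-injective (begin
  ℚ.toℚᵘ (+ suc k / 1)              ≈⟨ ℚ.toℚᵘ-fromℚᵘ (ℚᵘ.mkℚᵘ (+ suc k) 0) ⟩
  ℚᵘ.mkℚᵘ (+ suc k) 0               ≈⟨ ℚᵘ.*≡* (cong (ℤ._* + 1) eq) ⟩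
  ℚᵘ.mkℚᵘ (+ k) 0 ℚᵘ.+ ℚᵘ.1ℚᵘ       ≈⟨ ℚᵘ.+-congˡ ℚᵘ.1ℚᵘ (ℚ.toℚᵘ-fromℚᵘ (ℚᵘ.mkℚᵘ (+ k) 0)) ⟨
  ℚ.toℚᵘ (+ k / 1) ℚᵘ.+ ℚᵘ.1ℚᵘ      ≈⟨ ℚ.toℚᵘ-homo-+ (+ k / 1) 1ℚ ⟨
  ℚ.toℚᵘ (+ k / 1 + 1ℚ)             ∎)
  where
  open import Relation.Binary.Reasoning.Setoid ℚᵘ.≃-setoid
  eq : + suc k ≡ + k ℤ.* + 1 ℤ.+ + 1
  eq = trans (cong +_ (ℕ.+-comm 1 k)) (cong (ℤ._+ + 1) (sym (ℤ.*-identityʳ (+ k))))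

private
  ¼ ⅛ : ℚ
  ¼ = + 1 / 4
  ⅛ = + 1 / 8

  scale-pos : ∀ c .{{_ : ℚ.Positive c}} {ε} → 0ℚ ℚ.< ε → 0ℚ ℚ.< c ℚ.* ε
  scale-pos c {ε} 0<ε =
    subst (ℚ._< c ℚ.* ε) (ℚ.*-zeroʳ c) (ℚ.*-monoʳ-<-pos c 0<ε)

  p<p+q : ∀ p {q} → 0ℚ ℚ.< q → p ℚ.< p + q
  p<p+q p {q} 0<q = subst (ℚ._< p + q) (ℚ.+-identityʳ p) (ℚ.+-monoʳ-< p 0<q)

  p≤∣p∣ : ∀ p → p ℚ.≤ ∣ p ∣
  p≤∣p∣ p with ℚ.≤-total 0ℚ p
  ... | inj₁ 0≤p = ℚ.≤-reflexive (sym (ℚ.0≤p⇒∣p∣≡p 0≤p))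
  ... | inj₂ p≤0 = ℚ.≤-trans p≤0 (ℚ.0≤∣p∣ p)

  ∣p-q∣<ε⇒p<q+ε : ∀ p q {ε} → ∣ p - q ∣ ℚ.< ε → p ℚ.< q + ε
  ∣p-q∣<ε⇒p<q+ε p q {ε} lt = subst (ℚ._< q + ε)
    (solve 2 (λ p q → q :+ (p :- q) := p) refl p q)
    (ℚ.+-monoʳ-< q (ℚ.≤-<-trans (p≤∣p∣ (p - q)) lt))

  ∣p-q∣<ε⇒p≤q+ε : ∀ p q {ε} → ∣ p - q ∣ ℚ.< ε → p ℚ.≤ q + ε
  ∣p-q∣<ε⇒p≤q+ε p q = ℚ.<⇒≤ ∘ ∣p-q∣<ε⇒p<q+ε p q

fromℕ-mono-≤ : ∀ {k m} → k ℕ.≤ m → + k / 1 ℚ.≤ + m / 1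
fromℕ-mono-≤ {k} {m} k≤m with ℕ.≤⇒≤′ k≤m
... | ℕ.≤′-reflexive refl = ℚ.≤-refl
... | ℕ.≤′-step {m′} k≤′m′ = ℚ.≤-trans (fromℕ-mono-≤ (ℕ.≤′⇒≤ k≤′m′))
  (subst (+ m′ / 1 ℚ.≤_) (sym (fromℕ-suc m′)) (ℚ.<⇒≤ (p<p+q (+ m′ / 1) (ℚ.positive⁻¹ 1ℚ))))

<ᵣ-asym : ∀ {x y} → x <ᵣ y → ¬ (y <ᵣ x)
<ᵣ-asym {x} {y} (ε , 0<ε , N , h) (δ , 0<δ , N′ , h′) = ℚ.<-irrefl refl
  (begin-strict
    seq x n₀      <⟨ p<p+q (seq x n₀) 0<ε ⟩
    seq x n₀ + ε  ≤⟨ h n₀ (ℕ.m≤m⊔n N N′) ⟩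
    seq y n₀      <⟨ p<p+q (seq y n₀) 0<δ ⟩
    seq y n₀ + δ  ≤⟨ h′ n₀ (ℕ.m≤n⊔m N N′) ⟩
    seq x n₀      ∎)
  where
  n₀ = N ℕ.⊔ N′
  open ℚ.≤-Reasoning

-- At an index n₀ beyond which all three sequences vary by less than δ = ε/8,
-- z is compared with x + ε/2.
<ᵣ-cotrans : ∀ {x y} → x <ᵣ y → ∀ z → x <ᵣ z ⊎ z <ᵣ y
<ᵣ-cotrans {x} {y} (ε , 0<ε , N , h) z
  with cauchy x (⅛ ℚ.* ε) (scale-pos ⅛ 0<ε)
     | cauchy y (⅛ ℚ.* ε) (scale-pos ⅛ 0<ε)
     | cauchy z (⅛ ℚ.* ε) (scale-pos ⅛ 0<ε)
... | N₁ , hx | N₂ , hy | N₃ , hz =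
  [ inj₂ ∘ z-below-y , inj₁ ∘ x-below-z ]′ (ℚ.≤-total (seq z n₀) (seq x n₀ + ½ ℚ.* ε))
  where
  n₀ = N ℕ.⊔ (N₁ ℕ.⊔ (N₂ ℕ.⊔ N₃))
  δ = ⅛ ℚ.* ε

  N₁≤ : N₁ ≤ n₀
  N₁≤ = ℕ.m≤n⇒m≤o⊔n N (ℕ.m≤m⊔n N₁ (N₂ ℕ.⊔ N₃))
  N₂≤ : N₂ ≤ n₀
  N₂≤ = ℕ.m≤n⇒m≤o⊔n N (ℕ.m≤n⇒m≤o⊔n N₁ (ℕ.m≤m⊔n N₂ N₃))
  N₃≤ : N₃ ≤ n₀
  N₃≤ = ℕ.m≤n⇒m≤o⊔n N (ℕ.m≤n⇒m≤o⊔n N₁ (ℕ.m≤n⊔m N₂ N₃))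

  open ℚ.≤-Reasoning

  z-below-y : seq z n₀ ℚ.≤ seq x n₀ + ½ ℚ.* ε → z <ᵣ y
  -- The comparison with x + ε/2 leaves a gap of ε/2 on either side. Moving two sequences from `n₀`
  -- to `n` costs at most `δ` each, which leaves ε/4, here and in `x-below-z`.
  z-below-y z≤ = ¼ ℚ.* ε , scale-pos ¼ 0<ε , n₀ , λ n n₀≤n → begin
    seq z n + ¼ ℚ.* ε
      ≤⟨ ℚ.+-monoˡ-≤ (¼ ℚ.* ε) (∣p-q∣<ε⇒p≤q+ε (seq z n) (seq z n₀)
           (hz n n₀ (≤-trans N₃≤ n₀≤n) N₃≤)) ⟩
    seq z n₀ + δ + ¼ ℚ.* ε
      ≤⟨ ℚ.+-monoˡ-≤ (¼ ℚ.* ε) (ℚ.+-monoˡ-≤ δ z≤) ⟩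
    seq x n₀ + ½ ℚ.* ε + δ + ¼ ℚ.* ε
      ≡⟨ solve 2 (λ x e → x :+ con ½ :* e :+ con ⅛ :* e :+ con ¼ :* e
                        := x :+ e :- con ⅛ :* e) refl (seq x n₀) ε ⟩
    seq x n₀ + ε - δ
      ≤⟨ ℚ.+-monoˡ-≤ (- δ) (h n₀ (ℕ.m≤m⊔n N _)) ⟩
    seq y n₀ - δ
      ≤⟨ ℚ.+-monoˡ-≤ (- δ) (∣p-q∣<ε⇒p≤q+ε (seq y n₀) (seq y n)
           (hy n₀ n N₂≤ (≤-trans N₂≤ n₀≤n))) ⟩
    seq y n + δ - δ
      ≡⟨ solve 2 (λ y d → y :+ d :- d := y) refl (seq y n) δ ⟩
    seq y n ∎

  x-below-z : seq x n₀ + ½ ℚ.* ε ℚ.≤ seq z n₀ → x <ᵣ z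
  x-below-z ≤z = ¼ ℚ.* ε , scale-pos ¼ 0<ε , n₀ , λ n n₀≤n → begin
    seq x n + ¼ ℚ.* ε
      ≤⟨ ℚ.+-monoˡ-≤ (¼ ℚ.* ε) (∣p-q∣<ε⇒p≤q+ε (seq x n) (seq x n₀)
           (hx n n₀ (≤-trans N₁≤ n₀≤n) N₁≤)) ⟩
    seq x n₀ + δ + ¼ ℚ.* ε
      ≡⟨ solve 2 (λ x e → x :+ con ⅛ :* e :+ con ¼ :* e
                        := x :+ con ½ :* e :- con ⅛ :* e) refl (seq x n₀) ε ⟩
    seq x n₀ + ½ ℚ.* ε - δ
      ≤⟨ ℚ.+-monoˡ-≤ (- δ) ≤z ⟩
    seq z n₀ - δ
      ≤⟨ ℚ.+-monoˡ-≤ (- δ) (∣p-q∣<ε⇒p≤q+ε (seq z n₀) (seq z n)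
           (hz n₀ n N₃≤ (≤-trans N₃≤ n₀≤n))) ⟩
    seq z n + δ - δ
      ≡⟨ solve 2 (λ z d → z :+ d :- d := z) refl (seq z n) δ ⟩
    seq z n ∎

-- `_≤ᵣ_` is a negated strict inequality, so this is the contrapositive of cotransitivity.
≤ᵣ-trans : ∀ x y z → x ≤ᵣ y → y ≤ᵣ z → x ≤ᵣ z
≤ᵣ-trans x y z x≤y y≤z z<x = [ y≤z , x≤y ]′ (<ᵣ-cotrans {z} {x} z<x y)

≤ᵣ-total : ExcludedMiddle 0ℓ → ∀ x y → x ≤ᵣ y ⊎ y ≤ᵣ x
≤ᵣ-total em x y with em {y <ᵣ x}
... | yes y<x = inj₂ (<ᵣ-asym {y} {x} y<x)
... | no x≤y  = inj₁ x≤y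

≃-sym : ∀ x y → x ≃ y → y ≃ x
≃-sym x y x≃y ε 0<ε with x≃y ε 0<ε
... | N , h = N , λ n N≤n → subst (ℚ._< ε)
  (trans (sym (ℚ.∣-p∣≡∣p∣ (seq x n - seq y n)))
    (cong ∣_∣ (solve 2 (λ x y → :- (x :- y) := y :- x) refl (seq x n) (seq y n))))
  (h n N≤n)

≃⇒≤ᵣ : ∀ x y → x ≃ y → x ≤ᵣ y
≃⇒≤ᵣ x y x≃y (ε , 0<ε , N , h) with x≃y ε 0<ε
... | N′ , h′ = ℚ.<-irrefl refl (ℚ.<-≤-trans
    (∣p-q∣<ε⇒p<q+ε (seq x n₀) (seq y n₀) (h′ n₀ (ℕ.m≤n⊔m N N′)))
    (h n₀ (ℕ.m≤m⊔n N N′)))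
  where n₀ = N ℕ.⊔ N′

-- The order of two reals depends only on the sequence of their differences. Shifting or reflecting
-- an inequality thus becomes a pointwise identity of rationals for the ring solver.
≤ᵣ-diff : ∀ x y x′ y′ → (∀ n → seq y n - seq x n ≡ seq y′ n - seq x′ n) →
  x ≤ᵣ y → x′ ≤ᵣ y′
≤ᵣ-diff x y x′ y′ eq x≤y (ε , 0<ε , N , h) = x≤y (ε , 0<ε , N , λ n N≤n →
  subst₂ ℚ._≤_
    (trans (solve 4 (λ c x′ y′ e → (c :- x′) :+ (y′ :+ e) := (c :+ (y′ :- x′)) :+ e)
                  refl (seq x n) (seq x′ n) (seq y′ n) ε)
           (cong (_+ ε) (trans (cong (λ q → seq x n + q) (sym (eq n)))
             (solve 2 (λ x y → x :+ (y :- x) := y) refl (seq x n) (seq y n)))))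
    (solve 2 (λ x x′ → (x :- x′) :+ x′ := x) refl (seq x n) (seq x′ n))
    (ℚ.+-monoʳ-≤ (seq x n - seq x′ n) (h n N≤n)))

≃-pointwiseʳ : ∀ x y z → (∀ n → seq y n ≡ seq z n) → x ≃ y → x ≃ z
≃-pointwiseʳ x y z eq x≃y ε 0<ε with x≃y ε 0<ε
... | N , h = N , λ n N≤n →
  subst (λ q → ∣ seq x n - q ∣ ℚ.< ε) (eq n) (h n N≤n)

fromℚ-mono-≤ : ∀ {p q} → p ℚ.≤ q → fromℚ p ≤ᵣ fromℚ q
fromℚ-mono-≤ {p} {q} p≤q (ε , 0<ε , N , h) =
  ℚ.<-irrefl refl (ℚ.<-≤-trans (ℚ.≤-<-trans p≤q (p<p+q q 0<ε)) (h N ℕ.≤-refl))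

-- Half segments

-- On side 0F of the strip [k , k+1] a coordinate is measured from k, on
-- side 1F from k+1.
Coord : ℝ → ℝ → ℕ → Fin 2 → Set
Coord v d k 0F = v ≃ fromℕ k +ᵣ d
Coord v d k 1F = v ≃ fromℕ (suc k) -ᵣ d

Half : ℝ → Set
Half d = fromℚ 0ℚ ≤ᵣ d × d ≤ᵣ fromℚ ½

-- Depths in [0 , ½] on side `h` of strip `k` fill the interval from `bottom k h` to
-- `bottom k h + ½`.
bottom : ℕ → Fin 2 → ℚ
bottom k 0F = + k / 1
bottom k 1F = + k / 1 + ½

fromℕ-≤-bottom : ∀ k h → + k / 1 ℚ.≤ bottom k h
fromℕ-≤-bottom k 0F = ℚ.≤-refl
fromℕ-≤-bottom k 1F = subst (ℚ._≤ + k / 1 + ½) (ℚ.+-identityʳ (+ k / 1))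
  (ℚ.+-monoʳ-≤ (+ k / 1) (ℚ.nonNegative⁻¹ ½))

top-≤-suc : ∀ k h → bottom k h + ½ ℚ.≤ + suc k / 1
top-≤-suc k 0F = subst (+ k / 1 + ½ ℚ.≤_) (sym (fromℕ-suc k))
  (ℚ.+-monoʳ-≤ (+ k / 1) (ℚ.*≤* (ℤ.+≤+ (ℕ.s≤s ℕ.z≤n))))
top-≤-suc k 1F = ℚ.≤-reflexive (trans (ℚ.+-assoc (+ k / 1) ½ ½) (sym (fromℕ-suc k)))

coord-≥ : ∀ v d k h → Half d → Coord v d k h → fromℚ (bottom k h) ≤ᵣ v
coord-≥ v d k 0F (0≤d , _) v≃ =
  ≤ᵣ-trans (fromℕ k) (fromℕ k +ᵣ d) v
    (≤ᵣ-diff (fromℚ 0ℚ) d (fromℕ k) (fromℕ k +ᵣ d)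
      (λ n → solve 2 (λ k d → d :- con 0ℚ := k :+ d :- k) refl (+ k / 1) (seq d n)) 0≤d)
    (≃⇒≤ᵣ (fromℕ k +ᵣ d) v (≃-sym v (fromℕ k +ᵣ d) v≃))
coord-≥ v d k 1F (_ , d≤½) v≃ =
  ≤ᵣ-trans (fromℚ (bottom k 1F)) (fromℕ (suc k) -ᵣ d) v
    (≤ᵣ-diff d (fromℚ ½) (fromℚ (bottom k 1F)) (fromℕ (suc k) -ᵣ d)
      (λ n → trans
        (solve 2 (λ k d → con ½ :- d := k :+ con 1ℚ :- d :- (k :+ con ½)) refl (+ k / 1) (seq d n))
        (cong (λ q → q ℚ.- seq d n ℚ.- bottom k 1F) (sym (fromℕ-suc k)))) d≤½)
    (≃⇒≤ᵣ (fromℕ (suc k) -ᵣ d) v (≃-sym v (fromℕ (suc k) -ᵣ d) v≃))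

coord-≤ : ∀ v d k h → Half d → Coord v d k h → v ≤ᵣ fromℚ (bottom k h + ½)
coord-≤ v d k 0F (_ , d≤½) v≃ =
  ≤ᵣ-trans v (fromℕ k +ᵣ d) (fromℚ (bottom k 0F + ½))
    (≃⇒≤ᵣ v (fromℕ k +ᵣ d) v≃)
    (≤ᵣ-diff d (fromℚ ½) (fromℕ k +ᵣ d) (fromℚ (bottom k 0F + ½))
      (λ n → solve 2 (λ k d → con ½ :- d := k :+ con ½ :- (k :+ d)) refl (+ k / 1) (seq d n)) d≤½)
coord-≤ v d k 1F (0≤d , _) v≃ =
  ≤ᵣ-trans v (fromℕ (suc k) -ᵣ d) (fromℚ (bottom k 1F + ½))
    (≃⇒≤ᵣ v (fromℕ (suc k) -ᵣ d) v≃)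
    (≤ᵣ-diff (fromℚ 0ℚ) d (fromℕ (suc k) -ᵣ d) (fromℚ (bottom k 1F + ½))
      (λ n → trans
        (solve 2 (λ k d → d :- con 0ℚ := k :+ con ½ :+ con ½ :- (k :+ con 1ℚ :- d))
               refl (+ k / 1) (seq d n))
        (cong (λ q → bottom k 1F + ½ ℚ.- (q ℚ.- seq d n)) (sym (fromℕ-suc k)))) 0≤d)

Oriented : Rel A ℓ → Bool → A → A → Set ℓ
Oriented R true  x y = R x y
Oriented R false x y = R y x

-- Within one strip a point on side 0F lies before every deeper point, and a
-- point on side 1F after every deeper point, whichever side that point is on.
before : ℕ → Fin 2 → ℕ → Bool
before k h k′ with ℕ.<-cmp k k′ | h
... | tri< _ _ _ | _  = true
... | tri> _ _ _ | _  = false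
... | tri≈ _ _ _ | 0F = true
... | tri≈ _ _ _ | 1F = false

coord-≤-coord : ∀ v d k h v′ d′ k′ h′ → Half d → Half d′ → Coord v d k h → Coord v′ d′ k′ h′ →
  bottom k h + ½ ℚ.≤ bottom k′ h′ → v ≤ᵣ v′
coord-≤-coord v d k h v′ d′ k′ h′ D D′ V V′ top≤bottom =
  ≤ᵣ-trans v (fromℚ (bottom k h + ½)) v′ (coord-≤ v d k h D V)
    (≤ᵣ-trans (fromℚ (bottom k h + ½)) (fromℚ (bottom k′ h′)) v′
      (fromℚ-mono-≤ top≤bottom) (coord-≥ v′ d′ k′ h′ D′ V′))

coord-≤-later : ∀ v d k h v′ d′ k′ h′ → Half d → Half d′ → Coord v d k h → Coord v′ d′ k′ h′ →
  k ℕ.< k′ → v ≤ᵣ v′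
coord-≤-later v d k h v′ d′ k′ h′ D D′ V V′ k<k′ = coord-≤-coord v d k h v′ d′ k′ h′ D D′ V V′
  (ℚ.≤-trans (top-≤-suc k h) (ℚ.≤-trans (fromℕ-mono-≤ k<k′) (fromℕ-≤-bottom k′ h′)))

-- An integer weakly separates different strips, and k + ½ the two sides of one strip, whatever the
-- depths. On a common side the depths decide: side `0F` keeps their order, side `1F` reverses it.
coord-order : ∀ v d k h v′ d′ k′ h′ → Half d → Half d′ → Coord v d k h → Coord v′ d′ k′ h′ →
  d ≤ᵣ d′ → Oriented _≤ᵣ_ (before k h k′) v v′
coord-order v d k h v′ d′ k′ h′ D D′ V V′ d≤d′ with ℕ.<-cmp k k′ | h | h′
... | tri< k<k′ _ _ | h₁ | h₂ = coord-≤-later v d k h₁ v′ d′ k′ h₂ D D′ V V′ k<k′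
... | tri> _ _ k′<k | h₁ | h₂ = coord-≤-later v′ d′ k′ h₂ v d k h₁ D′ D V′ V k′<k
... | tri≈ _ refl _ | 0F | 1F = coord-≤-coord v d k 0F v′ d′ k 1F D D′ V V′ ℚ.≤-refl
... | tri≈ _ refl _ | 1F | 0F = coord-≤-coord v′ d′ k 0F v d k 1F D′ D V′ V ℚ.≤-refl
... | tri≈ _ refl _ | 0F | 0F =
  ≤ᵣ-trans v (fromℕ k +ᵣ d) v′ (≃⇒≤ᵣ v (fromℕ k +ᵣ d) V)
    (≤ᵣ-trans (fromℕ k +ᵣ d) (fromℕ k +ᵣ d′) v′
      (≤ᵣ-diff d d′ (fromℕ k +ᵣ d) (fromℕ k +ᵣ d′)
        (λ n → solve 3 (λ k d d′ → d′ :- d := k :+ d′ :- (k :+ d))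
                       refl (+ k / 1) (seq d n) (seq d′ n))
        d≤d′)
      (≃⇒≤ᵣ (fromℕ k +ᵣ d′) v′ (≃-sym v′ (fromℕ k +ᵣ d′) V′)))
... | tri≈ _ refl _ | 1F | 1F =
  ≤ᵣ-trans v′ (fromℕ (suc k) -ᵣ d′) v (≃⇒≤ᵣ v′ (fromℕ (suc k) -ᵣ d′) V′)
    (≤ᵣ-trans (fromℕ (suc k) -ᵣ d′) (fromℕ (suc k) -ᵣ d) v
      (≤ᵣ-diff d d′ (fromℕ (suc k) -ᵣ d′) (fromℕ (suc k) -ᵣ d)
        (λ n → solve 3 (λ k d d′ → d′ :- d := k :- d :- (k :- d′))
                       refl (+ suc k / 1) (seq d n) (seq d′ n))
        d≤d′)
      (≃⇒≤ᵣ (fromℕ (suc k) -ᵣ d) v (≃-sym v (fromℕ (suc k) -ᵣ d) V)))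

Cell : ℕ → ℕ → Set
Cell c r = (Fin c × Fin 2) × (Fin r × Fin 2)

-- Both coordinates share one depth. This is why a single listing by depth controls the horizontal
-- and the vertical order at once.
record Located (p : Point) (cell : Cell c r) : Set where
  field
    depth : ℝ
    half  : Half depth
    x-pos : let (k , h) , _ = cell in Coord (xcoord p) depth (toℕ k) h
    y-pos : let _ , (ℓ , h) = cell in Coord (ycoord p) depth (toℕ ℓ) h

open Located

-- The parameter `t` is cut at ½, and beyond it the depth is 1 - t, measured from the other end.
-- Both coordinates lie on the same side on a rising segment and on opposite sides on a falling one.
locate : ExcludedMiddle 0ℓ → (M : Matrix c r) → ∀ p → p ∈ StandardFigure M →
  ∃ (Located {c} {r} p)
locate em M p (k , ℓ , fig) = cases (M k ℓ) fig
  where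
  1ᵣ = fromℚ 1ℚ

  high : ∀ t → fromℚ ½ <ᵣ t → t ≤ᵣ 1ᵣ → Half (1ᵣ -ᵣ t)
  high t ½<t t≤1 =
    ≤ᵣ-diff t 1ᵣ (fromℚ 0ℚ) (1ᵣ -ᵣ t)
      (λ n → solve 1 (λ t → con 1ℚ :- t := con 1ℚ :- t :- con 0ℚ) refl (seq t n)) t≤1 ,
    ≤ᵣ-diff (fromℚ ½) t (1ᵣ -ᵣ t) (fromℚ ½)
      (λ n → solve 1 (λ t → t :- con ½ := con ½ :- (con 1ℚ :- t)) refl (seq t n))
      (<ᵣ-asym {fromℚ ½} {t} ½<t)

  from-far-end : ∀ v k t → v ≃ fromℕ k +ᵣ t → v ≃ fromℕ (suc k) -ᵣ (1ᵣ -ᵣ t)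
  from-far-end v k t = ≃-pointwiseʳ v (fromℕ k +ᵣ t) (fromℕ (suc k) -ᵣ (1ᵣ -ᵣ t)) λ n → trans
    (solve 2 (λ k t → k :+ t := k :+ con 1ℚ :- (con 1ℚ :- t)) refl (+ k / 1) (seq t n))
    (cong (λ q → q ℚ.- (1ℚ ℚ.- seq t n)) (sym (fromℕ-suc k)))

  from-near-end : ∀ v k t → v ≃ fromℕ (suc k) -ᵣ t → v ≃ fromℕ k +ᵣ (1ᵣ -ᵣ t)
  from-near-end v k t = ≃-pointwiseʳ v (fromℕ (suc k) -ᵣ t) (fromℕ k +ᵣ (1ᵣ -ᵣ t)) λ n → trans
    (cong (λ q → q ℚ.- seq t n) (fromℕ-suc k))
    (solve 2 (λ k t → k :+ con 1ℚ :- t := k :+ (con 1ℚ :- t)) refl (+ k / 1) (seq t n))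

  cases : ∀ e → p ∈ CellFigure e (toℕ k) (toℕ ℓ) → ∃ (Located p)
  cases 1# (t , 0≤t , t≤1 , x≃ , y≃) with em {fromℚ ½ <ᵣ t}
  ... | no t≤½ = ((k , 0F) , (ℓ , 0F)) , record
    { depth = t ; half = 0≤t , t≤½ ; x-pos = x≃ ; y-pos = y≃ }
  ... | yes ½<t = ((k , 1F) , (ℓ , 1F)) , record
    { depth = 1ᵣ -ᵣ t ; half = high t ½<t t≤1
    ; x-pos = from-far-end (xcoord p) (toℕ k) t x≃
    ; y-pos = from-far-end (ycoord p) (toℕ ℓ) t y≃ }
  cases -1# (t , 0≤t , t≤1 , x≃ , y≃) with em {fromℚ ½ <ᵣ t}
  ... | no t≤½ = ((k , 0F) , (ℓ , 1F)) , record
    { depth = t ; half = 0≤t , t≤½ ; x-pos = x≃ ; y-pos = y≃ }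
  ... | yes ½<t = ((k , 1F) , (ℓ , 0F)) , record
    { depth = 1ᵣ -ᵣ t ; half = high t ½<t t≤1
    ; x-pos = from-far-end (xcoord p) (toℕ k) t x≃
    ; y-pos = from-near-end (ycoord p) (toℕ ℓ) t y≃ }

-- Comparisons read off from words

Determined : (C → C → Bool) → (Fin n → C) → (Fin n → Fin m) → Set
Determined b w val = ∀ p q → p Fin.< q → Oriented Fin._<_ (b (w p) (w q)) (val p) (val q)

oriented-⇔ : ∀ β {i j : Fin m} {i′ j′ : Fin n} →
  Oriented Fin._<_ β i j → Oriented Fin._<_ β i′ j′ →
  (i Fin.< j ⇔ i′ Fin.< j′) × (j Fin.< i ⇔ j′ Fin.< i′)
oriented-⇔ true lt lt′ =
  mk⇔ (λ _ → lt′) (λ _ → lt) ,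
  mk⇔ (λ gt → contradiction gt (ℕ.<-asym lt)) (λ gt → contradiction gt (ℕ.<-asym lt′))
oriented-⇔ false lt lt′ =
  mk⇔ (λ gt → contradiction gt (ℕ.<-asym lt)) (λ gt → contradiction gt (ℕ.<-asym lt′)) ,
  mk⇔ (λ _ → lt′) (λ _ → lt)

-- An increasing map that preserves letters feeds the same two letters, in the same order, to `b`.
-- The values at `p` and `q` and those at their images therefore have the same strict orientation.
determined-⇔ : (b : C → C → Bool) (w : Fin m → C) (w′ : Fin n → C)
  (val : Fin m → Fin k) (val′ : Fin n → Fin l) (f : Fin m → Fin n) →
  Determined b w val → Determined b w′ val′ → Increasing f → (∀ p → w p ≡ w′ (f p)) →
  ∀ p q → val p Fin.< val q ⇔ val′ (f p) Fin.< val′ (f q)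
determined-⇔ b w w′ val val′ f det det′ f↑ w≗ = go
  where
  compare : ∀ p q → p Fin.< q → _
  compare p q p<q = oriented-⇔ (b (w p) (w q)) (det p q p<q)
    (subst (λ β → Oriented Fin._<_ β (val′ (f p)) (val′ (f q)))
      (sym (cong₂ b (w≗ p) (w≗ q))) (det′ (f p) (f q) (f↑ p q p<q)))
  go : ∀ p q → val p Fin.< val q ⇔ val′ (f p) Fin.< val′ (f q)
  go p q with Fin.<-cmp p q
  ... | tri< p<q _ _  = proj₁ (compare p q p<q)
  ... | tri> _ _ q<p  = proj₂ (compare q p q<p)
  ... | tri≈ _ refl _ = mk⇔ (λ lt → contradiction lt (ℕ.<-irrefl refl))
                            (λ lt → contradiction lt (ℕ.<-irrefl refl))

-- Coordinates are compared only weakly, since depths may tie. A weak inequality excludes the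
-- opposite strict order of `i` and `j`, and their distinctness does the rest.
oriented-strict : ∀ β (x y : ℝ) {i j : Fin n} → i ≢ j →
  (x <ᵣ y ⇔ i Fin.< j) → (y <ᵣ x ⇔ j Fin.< i) →
  Oriented _≤ᵣ_ β x y → Oriented Fin._<_ β i j
oriented-strict true  x y i≢j _ e x≤y =
  Fin.≤∧≢⇒< (ℕ.≮⇒≥ (x≤y ∘ Equivalence.from e)) i≢j
oriented-strict false x y i≢j e _ y≤x =
  Fin.≤∧≢⇒< (ℕ.≮⇒≥ (y≤x ∘ Equivalence.from e)) (≢-sym i≢j)

x-before y-before : Cell c r → Cell c r → Bool
x-before ((k , h) , _) ((k′ , _) , _) = before (toℕ k) h (toℕ k′)
y-before (_ , (ℓ , h)) (_ , (ℓ′ , _)) = before (toℕ ℓ) h (toℕ ℓ′)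

⟨$⟩ʳ-injective : (σ : Permutation′ n) → ∀ {i j} → σ ⟨$⟩ʳ i ≡ σ ⟨$⟩ʳ j → i ≡ j
⟨$⟩ʳ-injective σ eq = trans (sym (inverseˡ σ))
  (trans (cong (σ ⟨$⟩ˡ_) eq) (inverseˡ σ))

module _ {π : Permutation′ n} {pt : Fin n → Point} (same-order : SameRelativeOrder pt π)
         (cell : Fin n → Cell c r) (loc : ∀ i → Located (pt i) (cell i))
         (σ : Permutation′ n)
         (sorted : ∀ p q → p Fin.< q →
           depth (loc (σ ⟨$⟩ʳ p)) ≤ᵣ depth (loc (σ ⟨$⟩ʳ q))) where

  private
    s : Fin n → Fin n
    s = σ ⟨$⟩ʳ_

    col row : Fin n → ℕ
    col i = toℕ (proj₁ (proj₁ (cell i)))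
    row i = toℕ (proj₁ (proj₂ (cell i)))

    x-side y-side : Fin n → Fin 2
    x-side i = proj₂ (proj₁ (cell i))
    y-side i = proj₂ (proj₂ (cell i))

    s-≢ : ∀ {p q} → p Fin.< q → s p ≢ s q
    s-≢ p<q eq = Fin.<⇒≢ p<q (⟨$⟩ʳ-injective σ eq)

  x-determined : Determined x-before (cell ∘ s) s
  x-determined p q p<q =
    oriented-strict (x-before (cell i) (cell j)) (xcoord (pt i)) (xcoord (pt j)) (s-≢ p<q)
      (proj₁ (same-order i j)) (proj₁ (same-order j i))
      (coord-order (xcoord (pt i)) (depth (loc i)) (col i) (x-side i)
        (xcoord (pt j)) (depth (loc j)) (col j) (x-side j)
        (half (loc i)) (half (loc j)) (x-pos (loc i)) (x-pos (loc j)) (sorted p q p<q))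
    where
    i = s p
    j = s q

  y-determined : Determined y-before (cell ∘ s) (λ p → π ⟨$⟩ʳ s p)
  y-determined p q p<q =
    oriented-strict (y-before (cell i) (cell j)) (ycoord (pt i)) (ycoord (pt j))
      (s-≢ p<q ∘ ⟨$⟩ʳ-injective π)
      (proj₂ (same-order i j)) (proj₂ (same-order j i))
      (coord-order (ycoord (pt i)) (depth (loc i)) (row i) (y-side i)
        (ycoord (pt j)) (depth (loc j)) (row j) (y-side j)
        (half (loc i)) (half (loc j)) (y-pos (loc i)) (y-pos (loc j)) (sorted p q p<q))
    where
    i = s p
    j = s q

-- All that is kept of the geometry: `order` gives the index found at each position of the word, and
-- the letters in `cells` decide how indices and how values of `π` compare. No real numbers remain.
record Encoding (c r : ℕ) (π : Permutation′ n) : Set where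
  field
    cells        : Fin n → Cell c r
    order        : Permutation′ n
    x-determines : Determined x-before cells (order ⟨$⟩ʳ_)
    y-determines : Determined y-before cells (λ p → π ⟨$⟩ʳ (order ⟨$⟩ʳ p))

located⇒encoding : ExcludedMiddle 0ℓ → {π : Permutation′ n} {pt : Fin n → Point} →
  SameRelativeOrder pt π → (cell : Fin n → Cell c r) → (∀ i → Located (pt i) (cell i)) →
  Encoding c r π
located⇒encoding {n = n} em {π} {pt} same-order cell loc = record
  { cells        = λ p → cell (σ ⟨$⟩ʳ p)
  ; order        = σ
  ; x-determines = x-determined {π = π} {pt} same-order cell loc σ sorted
  ; y-determines = y-determined {π = π} {pt} same-order cell loc σ sorted
  }
  where
  by-depth : ∃ λ (σ : Permutation′ n) → ∀ p q → p Fin.< q →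
    depth (loc (σ ⟨$⟩ʳ p)) ≤ᵣ depth (loc (σ ⟨$⟩ʳ q))
  by-depth = sorting {_≼_ = _≤ᵣ_} (λ {x} {y} {z} → ≤ᵣ-trans x y z) (≤ᵣ-total em)
    (λ i → depth (loc i))
  σ = proj₁ by-depth
  sorted = proj₂ by-depth

encode : ExcludedMiddle 0ℓ → (M : Matrix c r) (π : Permutation′ n) →
  (n , π) ∈ Geom M → Encoding c r π
encode em M π (pt , on-figure , _ , same-order) =
  located⇒encoding em {π} {pt} same-order (λ i → proj₁ (loc i)) (λ i → proj₂ (loc i))
  where
  loc : ∀ i → ∃ (Located (pt i))
  loc i = locate em M (pt i) (on-figure i)

cell-wellQuasi : WellQuasi (_≡_ {A = Cell c r})
cell-wellQuasi {c} {r} f =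
  let i , j , i<j , eq = ≡-wellQuasi (code ∘ f)
  in i , j , i<j , code-injective eq
  where
  code : Cell c r → Fin ((c ℕ.* 2) ℕ.* (r ℕ.* 2))
  code ((k , h) , (ℓ , h′)) = combine (combine k h) (combine ℓ h′)
  code-injective : ∀ {x y} → code x ≡ code y → x ≡ y
  code-injective {(k , h) , (ℓ , h′)} {(k₁ , h₁) , (ℓ₁ , h₁′)} eq
    with eqx , eqy ← Fin.combine-injective (combine k h) _ (combine k₁ h₁) _ eq
    with refl , refl ← Fin.combine-injective k h k₁ h₁ eqx
    with refl , refl ← Fin.combine-injective ℓ h′ ℓ₁ h₁′ eqy = refl

-- Labelled permutations as words

module _ (X : Pred Perm ℓ) (L : Preorder a ℓ₁ ℓ₂) where

  private module L = Preorder L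
  open Labelled hiding (length)
  open Encoding

  private
    _≼_ : Rel (L.Carrier × Cell c r) ℓ₂
    (x , u) ≼ (x′ , u′) = x L.≲ x′ × u ≡ u′

    word : (π : Labelled X L) → Encoding c r (perm π) →
      Fin (Labelled.length π) → L.Carrier × Cell c r
    word π E p = label π (order E ⟨$⟩ʳ p) , cells E p

  -- The word embedding `f` acts on positions, so it is conjugated by the two listings to act on
  -- indices. The horizontal rule makes the result increasing, the vertical rule makes it preserve
  -- the pattern, and the letters carry the labels.
  word-embedding⇒≤ₗ : ∀ {π π′} (E : Encoding c r (perm π)) (E′ : Encoding c r (perm π′)) f →
    Increasing f → (∀ p → word π E p ≼ word π′ E′ (f p)) → _≤ₗ_ X L π π′
  word-embedding⇒≤ₗ {π = π} {π′} E E′ f f↑ letters = embedding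
    (λ i → σ′ ⟨$⟩ʳ f (σ ⟨$⟩ˡ i))
    (λ i j i<j → Equivalence.to (x-iso (σ ⟨$⟩ˡ i) (σ ⟨$⟩ˡ j))
      (subst₂ Fin._<_ (sym (inverseʳ σ)) (sym (inverseʳ σ)) i<j))
    (λ i j → subst₂
      (λ i′ j′ → (perm π ⟨$⟩ʳ i′) Fin.< (perm π ⟨$⟩ʳ j′) ⇔
        (perm π′ ⟨$⟩ʳ (σ′ ⟨$⟩ʳ f (σ ⟨$⟩ˡ i))) Fin.< (perm π′ ⟨$⟩ʳ (σ′ ⟨$⟩ʳ f (σ ⟨$⟩ˡ j))))
      (inverseʳ σ) (inverseʳ σ) (y-iso (σ ⟨$⟩ˡ i) (σ ⟨$⟩ˡ j)))
    (λ i → subst (λ i′ → label π i′ L.≲ label π′ (σ′ ⟨$⟩ʳ f (σ ⟨$⟩ˡ i))) (inverseʳ σ)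
      (proj₁ (letters (σ ⟨$⟩ˡ i))))
    where
    σ = order E
    σ′ = order E′
    x-iso = determined-⇔ x-before (cells E) (cells E′) (σ ⟨$⟩ʳ_) (σ′ ⟨$⟩ʳ_) f
      (x-determines E) (x-determines E′) f↑ (proj₂ ∘ letters)
    y-iso = determined-⇔ y-before (cells E) (cells E′)
      (λ p → perm π ⟨$⟩ʳ (σ ⟨$⟩ʳ p)) (λ p → perm π′ ⟨$⟩ʳ (σ′ ⟨$⟩ʳ p)) f
      (y-determines E) (y-determines E′) f↑ (proj₂ ∘ letters)

  encoded⇒wellQuasi : ExcludedMiddle (a ⊔ ℓ₂) → WQO L →
    (∀ (π : Labelled X L) → Encoding c r (perm π)) → WQO (X ≀ L)
  encoded⇒wellQuasi em L-wqo enc y =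
    let s , t , s<t , sub = Sublist-wellQuasi (λ s → tabulate (word (y s) (enc (y s))))
        f , f↑ , letters = Sublist⇒increasing (word (y s) (enc (y s))) (word (y t) (enc (y t))) sub
    in s , t , s<t , word-embedding⇒≤ₗ (enc (y s)) (enc (y t)) f f↑ letters
    where
    -- Cells must match exactly for the comparison rules to transfer. Since there are finitely many,
    -- equality on them is a well-quasi-order, and so is its product with the label order.
    open Higman {R = _≼_} em (λ (p , e) (p′ , e′) → L.trans p p′ , trans e e′)
      (×-wellQuasi (lower-em {ℓ′ = a} em) {R = L._≲_} L.trans L-wqo {S = _≡_} cell-wellQuasi)

theorem8p5 : ∀ {a ℓ₁ ℓ₂ : Level} → ExcludedMiddle (a ⊔ ℓ₂) →
    ∀ {c r : ℕ} (M : Matrix c r) → LWQO a ℓ₁ ℓ₂ (Geom M)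
theorem8p5 {a} {_} {ℓ₂} em M L L-wqo = encoded⇒wellQuasi (Geom M) L em L-wqo
  (λ π → encode (lower-em {ℓ′ = a ⊔ ℓ₂} em) M (Labelled.perm π) (Labelled.member π))
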